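{- Let $A$ be a finite alphabet. For every sentence $I$ over $A$, the coproduct of the coloured non-commutative elementary symmetric function $E_I$ in $\mathrm{NSym}_A$ is $$\Delta(E_I)=\sum_{J\subset I}E_{\widetilde J}\otimes E_{\widetilde{I\setminus J}},$$ which in the case of a single word $a_{i_1}a_{i_2}\cdots a_{i_k}$ with letters in $A$ gives $$\Delta(E_{(a_{i_1}a_{i_2}\cdots a_{i_k})})=\sum_{j=0}^{k}E_{(a_{i_{j+1}}\cdots a_{i_k})}\otimes E_{(a_{i_1}a_{i_2}\cdots a_{i_j})}.$$
   Context: $\Bbbk$ is a field of characteristic zero. A sentence $I=(w_1,\dots,w_m)$ over $A$ is a finite sequence of non-empty words in letters of $A$; $1$ is the empty sentence. $\ell(I)=m$, and $|I|$ is the total number of letters. $I\cdot J$ is concatenation of sequences of words. Write $J\preccurlyeq I$ ($J$ refines $I$) if the words of $I$ can be obtained by concatenating adjacent words of $J$. A weak sentence is a finite sequence of possibly empty words; $\widetilde J$ is obtained from $J$ by deleting the empty words. For a sentence $I=(w_1,\dots,w_m)$, a weak sentence $J=(v_1,\dots,v_m)$ satisfies $J\subset I$ if there is a weak sentence $I\setminus J:=(u_1,\dots,u_m)$ with $w_i=u_iv_i$ for all $i$. $\mathrm{NSym}_A$ is the Hopf algebra over $\Bbbk$ with linear basis $(H_I)$ indexed by sentences, product $H_I\cdot H_J=H_{I\cdot J}$, and coproduct $\Delta(H_I)=\sum_{J\subset I}H_{\widetilde{I\setminus J}}\otimes H_{\widetilde J}$. The elementary functions are $E_I=\sum_{J\preccurlyeq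 I}(-1)^{|I|-\ell(J)}H_J$. An index consisting of an empty word is read as the empty sentence, and $E_1=1$. -}

module Defs where

open import Algebra.Bundles using (CommutativeMonoid; CommutativeRing; Semiring)
open import Algebra.Module.Bundles using (Module)
open import Algebra.Module.Morphism.Structures using (module ModuleMorphisms)
open import Algebra.Module.Structures.Biased using (module IsModuleFromLeft)
import Algebra.Definitions
import Algebra.Definitions.RawSemiring
import Algebra.Properties.AbelianGroup
import Algebra.Properties.CommutativeSemigroup
import Algebra.Properties.Ring
open import Data.Empty using (⊥-elim)
open import Data.Fin.Base using (Fin)
open import Data.Fin.Properties using (inj⇒≟)
open import Data.List.Base
  using (List; []; _∷_; [_]; _++_; map; mapMaybe; concat; concatMap; foldr;
         length; cartesianProductWith; deduplicate)
import Data.List.Properties as List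
open import Data.List.Membership.Propositional using (_∈_)
open import Data.List.Membership.Propositional.Properties
  using (∈-map⁺; ∈-map⁻; ∈-++⁺ˡ; ∈-++⁺ʳ; ∈-cartesianProductWith⁺;
         ∈-deduplicate⁺)
open import Data.List.NonEmpty.Base as List⁺ using (List⁺; _∷_; _∷⁺_; toList)
open import Data.List.Relation.Binary.Pointwise using (Pointwise; []; _∷_)
open import Data.List.Relation.Unary.All as All using (All; []; _∷_)
import Data.List.Relation.Unary.All.Properties as All
open import Data.List.Relation.Unary.AllPairs using (AllPairs; []; _∷_)
open import Data.List.Relation.Unary.Any using (here; there)
open import Data.List.Relation.Unary.Unique.Propositional using (Unique)
import Data.List.Relation.Unary.Unique.Propositional.Properties as Unique
open import Data.List.Relation.Unary.Unique.DecPropositional.Properties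
  using (deduplicate-!)
open import Data.Nat.Base using (ℕ; zero; suc; _∸_)
open import Data.Nat.ListAction using (sum)
open import Data.Product.Base using (_×_; _,_; proj₁; proj₂; ∃; map₁; map₂)
open import Function.Base using (_∘_; id)
open import Function.Bundles using (_↔_)
open import Function.Properties.Inverse using (↔⇒↣)
open import Level using (Level; _⊔_) renaming (suc to lsuc)
open import Relation.Binary.Definitions using (DecidableEquality)
open import Relation.Binary.PropositionalEquality
  using (_≡_; _≢_; refl; sym; trans; cong; cong₂; subst)
import Relation.Binary.Reasoning.Setoid as ≈-Reasoning
open import Relation.Nullary using (¬_; yes; no)
open import Relation.Nullary.Decidable using (map′)

private
  variable
    a b : Level
    A : Set a
    B : Set b

record Field c ℓ : Set (lsuc (c ⊔ ℓ)) where
  field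
    commutativeRing : CommutativeRing c ℓ

  open CommutativeRing commutativeRing public
  open Algebra.Definitions _≈_ using (Invertible)

  field
    1≉0          : ¬ (1# ≈ 0#)
    ≉0⇒invertible : ∀ x → ¬ (x ≈ 0#) → Invertible 1# _*_ x

CharacteristicZero : ∀ {c ℓ} → Field c ℓ → Set ℓ
CharacteristicZero K = ∀ n → n ×′ 1# ≈ 0# → n ≡ 0
  where
  open Field K
  open Algebra.Definitions.RawSemiring (Semiring.rawSemiring semiring)
    renaming (_×_ to _×′_) using ()

Word : Set a → Set a
Word A = List⁺ A

Sentence : Set a → Set a
Sentence A = List (Word A)

WeakSentence : Set a → Set a
WeakSentence A = List (List A)

∣_∣ : Sentence A → ℕ
∣ I ∣ = sum (map List⁺.length I)

infix 9 _~

_~ : WeakSentence A → Sentence A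
J ~ = mapMaybe List⁺.fromList J

-- The sentence with single word v, which is the empty sentence when v is
-- the empty word.
⟨_⟩ : List A → Sentence A
⟨ v ⟩ = [ v ] ~

-- J ≼ I (J refines I) when J can be cut into blocks of adjacent words such that
-- concatenating the words of each block gives I.
infix 4 _≼_

_≼_ : {A : Set a} → Sentence A → Sentence A → Set a
_≼_ {A = A} J I =
  ∃ λ (Gs : List (List⁺ (Word A))) →
    concatMap toList Gs ≡ J × map List⁺.concat Gs ≡ I

-- Words are cut as w = u v, and J keeps the suffixes v; the prefixes u form I ∖ J.
infix 4 _⊂_

_⊂_ : {A : Set a} → WeakSentence A → Sentence A → Set a
_⊂_ {A = A} J I = Pointwise (λ v w → ∃ λ (u : List A) → toList w ≡ u ++ v) J I

infix 8 _∖_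

_∖_ : (I : Sentence A) {J : WeakSentence A} → J ⊂ I → WeakSentence A
[]      ∖ []              = []
(_ ∷ I) ∖ ((u , _) ∷ J⊂I) = u ∷ I ∖ J⊂I

∖-unique : ∀ {I : Sentence A} {J} (p q : J ⊂ I) → I ∖ p ≡ I ∖ q
∖-unique []             []              = refl
∖-unique {I = _ ∷ _} {J = v ∷ _} ((u , p) ∷ ps) ((u′ , q) ∷ qs) =
  cong₂ _∷_ (List.++-cancelʳ v u u′ (trans (sym p) q)) (∖-unique ps qs)

extendHead : A → List⁺ (Word A) → List⁺ (Word A)
extendHead x (v ∷ vs) = (x ∷⁺ v) ∷ vs

-- All ways of writing the word x ∷ w as a concatenation of non-empty words.
blocks : A → List A → List (List⁺ (Word A))
blocks x []      = [ List⁺.[ List⁺.[ x ] ] ]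
blocks x (y ∷ w) = map (List⁺.[ x ] ∷⁺_) (blocks y w) ++ map (extendHead x) (blocks y w)

groupings : Sentence A → List (List (List⁺ (Word A)))
groupings []            = [ [] ]
groupings ((x ∷ w) ∷ I) = cartesianProductWith _∷_ (blocks x w) (groupings I)

-- Lists each J ≼ I exactly once; see refinements-sound, -complete and -unique.
refinements : Sentence A → List (Sentence A)
refinements I = map (concatMap toList) (groupings I)

private
  blocks-sound : ∀ (x : A) w → All (λ G → List⁺.concat G ≡ x ∷ w) (blocks x w)
  blocks-sound x []      = refl ∷ []
  blocks-sound x (y ∷ w) = All.++⁺
    (All.map⁺ (All.map (λ { {v ∷ vs} refl → refl }) (blocks-sound y w)))
    (All.map⁺ (All.map (λ { {(z ∷ v) ∷ vs} refl → refl }) (blocks-sound y w)))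

  ∷-tail : ∀ {x y z v : A} {xs ys : List A} →
           _≡_ {A = List⁺ A} (x ∷ y ∷ xs) (z ∷ v ∷ ys) →
           _≡_ {A = List⁺ A} (y ∷ xs) (v ∷ ys)
  ∷-tail refl = refl

  blocks-complete : ∀ (x : A) w G → List⁺.concat G ≡ x ∷ w → G ∈ blocks x w
  blocks-complete x [] ((_ ∷ []) ∷ []) refl = here refl
  blocks-complete x [] ((_ ∷ []) ∷ ((_ ∷ _) ∷ _)) ()
  blocks-complete x (y ∷ w) ((_ ∷ []) ∷ ((z ∷ v) ∷ vs)) eq
    with refl ← cong List⁺.head eq =
    ∈-++⁺ˡ (∈-map⁺ _ (blocks-complete y w ((z ∷ v) ∷ vs) (∷-tail eq)))
  blocks-complete x (y ∷ w) ((_ ∷ (z ∷ v)) ∷ vs) eq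
    with refl ← cong List⁺.head eq =
    ∈-++⁺ʳ (map _ (blocks y w))
      (∈-map⁺ _ (blocks-complete y w ((z ∷ v) ∷ vs) (∷-tail eq)))

  blocks-unique : ∀ (x : A) w → Unique (blocks x w)
  blocks-unique x []      = [] ∷ []
  blocks-unique x (y ∷ w) = Unique.++⁺
    (Unique.map⁺ (λ { {v ∷ vs} {v′ ∷ vs′} refl → refl }) (blocks-unique y w))
    (Unique.map⁺ (λ { {(z ∷ v) ∷ vs} {(z′ ∷ v′) ∷ vs′} refl → refl })
      (blocks-unique y w))
    disjoint
    where
    disjoint : ∀ {G} → ¬ (G ∈ map (List⁺.[ x ] ∷⁺_) (blocks y w)
                         × G ∈ map (extendHead x) (blocks y w))
    disjoint (p , q) with ∈-map⁻ _ p | ∈-map⁻ _ q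
    ... | (v ∷ vs) , _ , refl | ((z ∷ v′) ∷ vs′) , _ , ()

  groupings-sound : ∀ (I : Sentence A) → All (λ Gs → map List⁺.concat Gs ≡ I) (groupings I)
  groupings-sound []            = refl ∷ []
  groupings-sound ((x ∷ w) ∷ I) = All.tabulate λ p → go p
    where
    open import Data.List.Membership.Propositional.Properties
      using (∈-cartesianProductWith⁻)
    go : ∀ {Gs} → Gs ∈ groupings ((x ∷ w) ∷ I) → map List⁺.concat Gs ≡ (x ∷ w) ∷ I
    go p with ∈-cartesianProductWith⁻ _∷_ (blocks x w) (groupings I) p
    ... | G , Gs , G∈ , Gs∈ , refl =
      cong₂ _∷_ (All.lookup (blocks-sound x w) G∈)
                (All.lookup (groupings-sound I) Gs∈)

  groupings-complete : ∀ (I : Sentence A) Gs → map List⁺.concat Gs ≡ I → Gs ∈ groupings I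
  groupings-complete []            []       refl = here refl
  groupings-complete ((x ∷ w) ∷ I) (G ∷ Gs) eq   =
    ∈-cartesianProductWith⁺ _∷_
      (blocks-complete x w G (List.∷-injectiveˡ eq))
      (groupings-complete I Gs (List.∷-injectiveʳ eq))

  groupings-unique : ∀ (I : Sentence A) → Unique (groupings I)
  groupings-unique []            = [] ∷ []
  groupings-unique ((x ∷ w) ∷ I) =
    Unique.cartesianProductWith⁺ _∷_ List.∷-injective
      (blocks-unique x w) (groupings-unique I)

  letters : Sentence A → List A
  letters = concatMap toList

  prefix-unique : ∀ (g g′ : Sentence A) {r r′} → letters g ≡ letters g′ →
                  g ++ r ≡ g′ ++ r′ → g ≡ g′ × r ≡ r′
  prefix-unique []      []        p q = refl , q
  prefix-unique (x ∷ g) (x′ ∷ g′) p q with List.∷-injective q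
  ... | refl , q′ = map₁ (cong (x ∷_))
    (prefix-unique g g′ (List.++-cancelˡ (toList x) _ _ p) q′)

  grouping-unique : ∀ (Gs Gs′ : List (List⁺ (Word A))) →
                    map List⁺.concat Gs ≡ map List⁺.concat Gs′ →
                    concatMap toList Gs ≡ concatMap toList Gs′ → Gs ≡ Gs′
  grouping-unique [] [] _ _ = refl
  grouping-unique (G@(_ ∷ _) ∷ Gs) (G′@(_ ∷ _) ∷ Gs′) p q
    with prefix-unique (toList G) (toList G′)
           (cong toList (List.∷-injectiveˡ p)) q
  ... | refl , q′ = cong (G ∷_) (grouping-unique Gs Gs′ (List.∷-injectiveʳ p) q′)

  map-unique : ∀ {P : A → Set b} {f : A → B} {xs} →
               (∀ {x y} → P x → P y → f x ≡ f y → x ≡ y) →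
               All P xs → Unique xs → Unique (map f xs)
  map-unique inj []         []       = []
  map-unique inj (px ∷ pxs) (n ∷ xs!) =
    All.map⁺ (All.zipWith (λ (py , x≢y) fx≡fy → x≢y (inj px py fx≡fy)) (pxs , n))
      ∷ map-unique inj pxs xs!

refinements-sound : ∀ (I : Sentence A) → All (_≼ I) (refinements I)
refinements-sound I =
  All.map⁺ (All.map (λ {Gs} eq → Gs , refl , eq) (groupings-sound I))

refinements-complete : ∀ {I J : Sentence A} → J ≼ I → J ∈ refinements I
refinements-complete {I = I} (Gs , refl , eq) =
  ∈-map⁺ _ (groupings-complete I Gs eq)

refinements-unique : ∀ (I : Sentence A) → Unique (refinements I)
refinements-unique I = map-unique
  (λ p q → grouping-unique _ _ (trans p (sym q)))
  (groupings-sound I) (groupings-unique I)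

suffixes : (w : List A) → List (∃ λ v → ∃ λ u → w ≡ u ++ v)
suffixes []      = [ [] , [] , refl ]
suffixes (x ∷ w) =
  (x ∷ w , [] , refl)
    ∷ map (map₂ λ (u , eq) → x ∷ u , cong (x ∷_) eq) (suffixes w)

infixr 5 _∷ˢ_

_∷ˢ_ : ∀ {w : Word A} {I : Sentence A} →
       (∃ λ v → ∃ λ u → toList w ≡ u ++ v) → (∃ λ J → J ⊂ I) → ∃ λ J → J ⊂ w ∷ I
(v , p) ∷ˢ (J , J⊂I) = v ∷ J , p ∷ J⊂I

-- Lists each J with J ⊂ I exactly once, as a weak sentence; different J may
-- give the same sentence J ~.
subsentences : (I : Sentence A) → List (∃ λ J → J ⊂ I)
subsentences []      = [ [] , [] ]
subsentences (w ∷ I) = cartesianProductWith _∷ˢ_ (suffixes (toList w)) (subsentences I)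

private
  suffixes-complete : ∀ (u v w : List A) → w ≡ u ++ v →
                      v ∈ map proj₁ (suffixes w)
  suffixes-complete [] [] _ refl = here refl
  suffixes-complete [] (x ∷ v) _ refl = here refl
  suffixes-complete (x ∷ u) v _ refl =
    there (subst (v ∈_) (List.map-∘ (suffixes (u ++ v)))
      (suffixes-complete u v (u ++ v) refl))

  suffixes-unique : ∀ (w : List A) → Unique (map proj₁ (suffixes w))
  suffixes-unique []      = [] ∷ []
  suffixes-unique (x ∷ w) =
    All.map⁺ (All.map⁺ (All.tabulate λ {s} _ → longer s))
      ∷ subst Unique (List.map-∘ (suffixes w)) (suffixes-unique w)
    where
    open import Data.Nat.Properties using (m≢1+n+m)
    longer : (s : ∃ λ v → ∃ λ u → w ≡ u ++ v) → x ∷ w ≢ proj₁ s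
    longer (v , u , refl) eq = m≢1+n+m (length v)
      (trans (cong length (sym eq)) (cong suc (List.length-++ u)))

  map-proj₁-subsentences : ∀ w (I : Sentence A) →
    map proj₁ (subsentences (w ∷ I)) ≡
    cartesianProductWith _∷_
      (map proj₁ (suffixes (toList w))) (map proj₁ (subsentences I))
  map-proj₁-subsentences w I = go (suffixes (toList w))
    where
    go : ∀ ss →
      map proj₁ (cartesianProductWith (_∷ˢ_ {w = w}) ss (subsentences I))
      ≡ cartesianProductWith _∷_ (map proj₁ ss) (map proj₁ (subsentences I))
    go []       = refl
    go (s ∷ ss) = trans (List.map-++ proj₁ (map _ (subsentences I)) _)
      (cong₂ _++_
        (trans (sym (List.map-∘ (subsentences I))) (List.map-∘ (subsentences I)))
        (go ss))

subsentences-complete : ∀ {I : Sentence A} {J} → J ⊂ I →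
                        J ∈ map proj₁ (subsentences I)
subsentences-complete [] = here refl
subsentences-complete {I = w ∷ I} {J = v ∷ J} ((u , eq) ∷ J⊂I) =
  subst (v ∷ J ∈_) (sym (map-proj₁-subsentences w I))
    (∈-cartesianProductWith⁺ _∷_ (suffixes-complete u v (toList w) eq)
      (subsentences-complete J⊂I))

subsentences-unique : ∀ (I : Sentence A) → Unique (map proj₁ (subsentences I))
subsentences-unique []      = [] ∷ []
subsentences-unique (w ∷ I) =
  subst Unique (sym (map-proj₁-subsentences w I))
    (Unique.cartesianProductWith⁺ _∷_ List.∷-injective
      (suffixes-unique (toList w)) (subsentences-unique I))

module FiniteSum {r ℓr m ℓm} {R : CommutativeRing r ℓr} (M : Module R m ℓm) where
  open Module M

  ∑ : List B → (B → Carrierᴹ) → Carrierᴹ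
  ∑ xs f = foldr _+ᴹ_ 0ᴹ (map f xs)

module TensorProduct {r ℓr m ℓm n ℓn} {R : CommutativeRing r ℓr}
                     (M : Module R m ℓm) (N : Module R n ℓn) where
  private
    module R = CommutativeRing R
    module M = Module M
    module N = Module N

  -- A list stands for the sum of the pure tensors of its entries.
  Tensor : Set (m ⊔ n)
  Tensor = List (M.Carrierᴹ × N.Carrierᴹ)

  infix 8 _⊗_

  _⊗_ : M.Carrierᴹ → N.Carrierᴹ → Tensor
  x ⊗ y = [ x , y ]

  infix 4 _≈⊗_

  data _≈⊗_ : Tensor → Tensor → Set (r ⊔ m ⊔ ℓm ⊔ n ⊔ ℓn) where
    ≈-refl   : ∀ {s} → s ≈⊗ s
    ≈-sym    : ∀ {s t} → s ≈⊗ t → t ≈⊗ s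
    ≈-trans  : ∀ {s t u} → s ≈⊗ t → t ≈⊗ u → s ≈⊗ u
    +-cong   : ∀ {s s′ t t′} → s ≈⊗ s′ → t ≈⊗ t′ → s ++ t ≈⊗ s′ ++ t′
    +-comm   : ∀ s t → s ++ t ≈⊗ t ++ s
    ⊗-cong   : ∀ {x x′ y y′} → x M.≈ᴹ x′ → y N.≈ᴹ y′ → x ⊗ y ≈⊗ x′ ⊗ y′
    -- Not derivable from the other rules, since tensors are built as a free
    -- monoid rather than a free group.
    ⊗-zeroˡ  : ∀ y → M.0ᴹ ⊗ y ≈⊗ []
    ⊗-distribʳ : ∀ x x′ y → (x M.+ᴹ x′) ⊗ y ≈⊗ x ⊗ y ++ x′ ⊗ y
    ⊗-distribˡ : ∀ x y y′ → x ⊗ (y N.+ᴹ y′) ≈⊗ x ⊗ y ++ x ⊗ y′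
    ⊗-balanced : ∀ c x y → (c M.*ₗ x) ⊗ y ≈⊗ x ⊗ (c N.*ₗ y)

  private
    -⊗_ : Tensor → Tensor
    -⊗_ = map (map₁ M.-ᴹ_)

    _*⊗_ : R.Carrier → Tensor → Tensor
    c *⊗ t = map (map₁ (c M.*ₗ_)) t

    ≡⇒≈ : ∀ {s t} → s ≡ t → s ≈⊗ t
    ≡⇒≈ refl = ≈-refl

    mapˡ-cong : (f : M.Carrierᴹ → M.Carrierᴹ) →
                (∀ {x y} → x M.≈ᴹ y → f x M.≈ᴹ f y) →
                f M.0ᴹ M.≈ᴹ M.0ᴹ →
                (∀ x y → f (x M.+ᴹ y) M.≈ᴹ f x M.+ᴹ f y) →
                (∀ c x → f (c M.*ₗ x) M.≈ᴹ c M.*ₗ f x) →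
                ∀ {s t} → s ≈⊗ t → map (map₁ f) s ≈⊗ map (map₁ f) t
    mapˡ-cong f f-cong f0 f+ f* = go
      where
      go : ∀ {s t} → s ≈⊗ t → map (map₁ f) s ≈⊗ map (map₁ f) t
      go ≈-refl        = ≈-refl
      go (≈-sym p)     = ≈-sym (go p)
      go (≈-trans p q) = ≈-trans (go p) (go q)
      go (+-cong {s} {s′} p q) = ≈-trans (≡⇒≈ (List.map-++ _ s _))
        (≈-trans (+-cong (go p) (go q)) (≡⇒≈ (sym (List.map-++ _ s′ _))))
      go (+-comm s t) = ≈-trans (≡⇒≈ (List.map-++ _ s t))
        (≈-trans (+-comm (map (map₁ f) s) (map (map₁ f) t)) (≡⇒≈ (sym (List.map-++ _ t s))))
      go (⊗-cong p q)         = ⊗-cong (f-cong p) q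
      go (⊗-zeroˡ y)          = ≈-trans (⊗-cong f0 N.≈ᴹ-refl) (⊗-zeroˡ y)
      go (⊗-distribʳ x x′ y)  =
        ≈-trans (⊗-cong (f+ x x′) N.≈ᴹ-refl) (⊗-distribʳ (f x) (f x′) y)
      go (⊗-distribˡ x y y′)  = ⊗-distribˡ (f x) y y′
      go (⊗-balanced c x y)   =
        ≈-trans (⊗-cong (f* c x) N.≈ᴹ-refl) (⊗-balanced c (f x) y)

    pointwise : (f g : M.Carrierᴹ → M.Carrierᴹ) → (∀ x → f x M.≈ᴹ g x) →
                ∀ t → map (map₁ f) t ≈⊗ map (map₁ g) t
    pointwise f g f≈g []            = ≈-refl
    pointwise f g f≈g ((x , y) ∷ t) =
      +-cong (⊗-cong (f≈g x) N.≈ᴹ-refl) (pointwise f g f≈g t)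

    pointwise-+ : (f g h : M.Carrierᴹ → M.Carrierᴹ) →
                  (∀ x → f x M.≈ᴹ g x M.+ᴹ h x) →
                  ∀ t → map (map₁ f) t ≈⊗ map (map₁ g) t ++ map (map₁ h) t
    pointwise-+ f g h f≈g+h [] = ≈-refl
    pointwise-+ f g h f≈g+h ((x , y) ∷ t) = ≈-trans
      (+-cong (≈-trans (⊗-cong (f≈g+h x) N.≈ᴹ-refl) (⊗-distribʳ (g x) (h x) y))
              (pointwise-+ f g h f≈g+h t))
      (+-cong {g x ⊗ y} ≈-refl
        (≈-trans (≡⇒≈ (sym (List.++-assoc (h x ⊗ y) G H)))
          (≈-trans (+-cong (+-comm (h x ⊗ y) G) (≈-refl {H}))
                   (≡⇒≈ (List.++-assoc G (h x ⊗ y) H)))))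
      where
      G = map (map₁ g) t
      H = map (map₁ h) t

    pointwise-0 : (f : M.Carrierᴹ → M.Carrierᴹ) → (∀ x → f x M.≈ᴹ M.0ᴹ) →
                  ∀ t → map (map₁ f) t ≈⊗ []
    pointwise-0 f f≈0 []            = ≈-refl
    pointwise-0 f f≈0 ((x , y) ∷ t) =
      +-cong (≈-trans (⊗-cong (f≈0 x) N.≈ᴹ-refl) (⊗-zeroˡ y)) (pointwise-0 f f≈0 t)

    module MG = Algebra.Properties.AbelianGroup M.+ᴹ-abelianGroup

    -‿*ₗ : ∀ c x → M.-ᴹ (c M.*ₗ x) M.≈ᴹ c M.*ₗ (M.-ᴹ x)
    -‿*ₗ c x = M.≈ᴹ-sym (MG.inverseʳ-unique (c M.*ₗ x) (c M.*ₗ (M.-ᴹ x))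
      (M.≈ᴹ-trans (M.≈ᴹ-sym (M.*ₗ-distribˡ c x (M.-ᴹ x)))
        (M.≈ᴹ-trans (M.*ₗ-cong R.refl (M.-ᴹ‿inverseʳ x)) (M.*ₗ-zeroʳ c))))

    -⊗-cong : ∀ {s t} → s ≈⊗ t → -⊗ s ≈⊗ -⊗ t
    -⊗-cong = mapˡ-cong M.-ᴹ_ M.-ᴹ‿cong MG.ε⁻¹≈ε
      (λ x y → M.≈ᴹ-sym (MG.⁻¹-∙-comm x y)) -‿*ₗ

    map-id₁ : ∀ (t : Tensor) → map (map₁ id) t ≡ t
    map-id₁ t = List.map-id t

    -⊗-inverseˡ : ∀ t → (-⊗ t) ++ t ≈⊗ []
    -⊗-inverseˡ t = ≈-trans
      (≈-trans (≡⇒≈ (cong ((-⊗ t) ++_) (sym (map-id₁ t))))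
        (≈-sym (pointwise-+ (λ _ → M.0ᴹ) M.-ᴹ_ id (λ x → M.≈ᴹ-sym (M.-ᴹ‿inverseˡ x)) t)))
      (pointwise-0 (λ _ → M.0ᴹ) (λ _ → M.≈ᴹ-refl) t)

  tensorProduct : Module R (m ⊔ n) (r ⊔ m ⊔ ℓm ⊔ n ⊔ ℓn)
  tensorProduct = record
    { Carrierᴹ = Tensor
    ; _≈ᴹ_     = _≈⊗_
    ; _+ᴹ_     = _++_
    ; _*ₗ_     = _*⊗_
    ; _*ᵣ_     = λ t c → c *⊗ t
    ; 0ᴹ       = []
    ; -ᴹ_      = -⊗_
    ; isModule = IsModuleFromLeft.isModule {commutativeRing = R} (record
      { isLeftModule = record
        { isLeftSemimodule = record
          { +ᴹ-isCommutativeMonoid = record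
            { isMonoid = record
              { isSemigroup = record
                { isMagma = record
                  { isEquivalence = record
                    { refl = ≈-refl ; sym = ≈-sym ; trans = ≈-trans }
                  ; ∙-cong = +-cong
                  }
                ; assoc = λ s t u → ≡⇒≈ (List.++-assoc s t u)
                }
              ; identity = (λ _ → ≈-refl) , (λ t → ≡⇒≈ (List.++-identityʳ t))
              }
            ; comm = +-comm
            }
          ; isPreleftSemimodule = record
            { *ₗ-cong = λ {c} {d} {s} {t} c≈d s≈t → ≈-trans
                (pointwise (c M.*ₗ_) (d M.*ₗ_) (λ _ → M.*ₗ-cong c≈d M.≈ᴹ-refl) s)
                (mapˡ-cong (d M.*ₗ_) (M.*ₗ-cong R.refl) (M.*ₗ-zeroʳ d)
                  (M.*ₗ-distribˡ d) (*ₗ-comm d) s≈t)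
            ; *ₗ-zeroˡ     = pointwise-0 (R.0# M.*ₗ_) M.*ₗ-zeroˡ
            ; *ₗ-distribʳ  = λ t c d →
                pointwise-+ _ (c M.*ₗ_) (d M.*ₗ_) (λ x → M.*ₗ-distribʳ x c d) t
            ; *ₗ-identityˡ = λ t → ≈-trans
                (pointwise (R.1# M.*ₗ_) id M.*ₗ-identityˡ t) (≡⇒≈ (map-id₁ t))
            ; *ₗ-assoc     = λ c d t → ≈-trans
                (pointwise _ (λ x → c M.*ₗ d M.*ₗ x) (M.*ₗ-assoc c d) t)
                (≡⇒≈ (List.map-∘ t))
            ; *ₗ-zeroʳ     = λ _ → ≈-refl
            ; *ₗ-distribˡ  = λ c s t → ≡⇒≈ (List.map-++ _ s t)
            }
          }
        ; -ᴹ‿cong    = -⊗-cong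
        ; -ᴹ‿inverse = -⊗-inverseˡ , λ t → ≈-trans (+-comm t (-⊗ t)) (-⊗-inverseˡ t)
        }
      })
    }
    where
    *ₗ-comm : ∀ d c x → d M.*ₗ c M.*ₗ x M.≈ᴹ c M.*ₗ d M.*ₗ x
    *ₗ-comm d c x = M.≈ᴹ-trans (M.≈ᴹ-sym (M.*ₗ-assoc d c x))
      (M.≈ᴹ-trans (M.*ₗ-cong (R.*-comm d c) M.≈ᴹ-refl) (M.*ₗ-assoc c d x))

module FreeModule {r ℓr b} (R : CommutativeRing r ℓr)
                  {B : Set b} (_≟_ : DecidableEquality B) where
  private
    module R = CommutativeRing R
    module RP = Algebra.Properties.Ring R.ring
    module RG = Algebra.Properties.AbelianGroup R.+-abelianGroup

  -- Formal sums ∑ cᵢ bᵢ; the bᵢ may repeat.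
  FormalSum : Set (r ⊔ b)
  FormalSum = List (R.Carrier × B)

  coeff : FormalSum → B → R.Carrier
  coeff []             y = R.0#
  coeff ((c , x) ∷ xs) y with x ≟ y
  ... | yes _ = c R.+ coeff xs y
  ... | no  _ = coeff xs y

  infix 4 _≈ᶠ_

  _≈ᶠ_ : FormalSum → FormalSum → Set (b ⊔ ℓr)
  xs ≈ᶠ ys = ∀ z → coeff xs z R.≈ coeff ys z

  private
    coeff-++ : ∀ xs ys z → coeff (xs ++ ys) z R.≈ coeff xs z R.+ coeff ys z
    coeff-++ []             ys z = R.sym (R.+-identityˡ _)
    coeff-++ ((c , x) ∷ xs) ys z with x ≟ z
    ... | yes _ = R.trans (R.+-congˡ (coeff-++ xs ys z)) (R.sym (R.+-assoc _ _ _))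
    ... | no  _ = coeff-++ xs ys z

    coeff-map : (f : R.Carrier → R.Carrier) → f R.0# R.≈ R.0# →
                (∀ c d → f (c R.+ d) R.≈ f c R.+ f d) →
                ∀ xs z → coeff (map (map₁ f) xs) z R.≈ f (coeff xs z)
    coeff-map f f0 f+ []             z = R.sym f0
    coeff-map f f0 f+ ((c , x) ∷ xs) z with x ≟ z
    ... | yes _ = R.trans (R.+-congˡ (coeff-map f f0 f+ xs z)) (R.sym (f+ _ _))
    ... | no  _ = coeff-map f f0 f+ xs z

    -ᶠ_ : FormalSum → FormalSum
    -ᶠ_ = map (map₁ (λ c → R.- c))

    _*ᶠ_ : R.Carrier → FormalSum → FormalSum
    c *ᶠ xs = map (map₁ (c R.*_)) xs

    coeff-- : ∀ xs z → coeff (-ᶠ xs) z R.≈ R.- coeff xs z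
    coeff-- = coeff-map (λ c → R.- c) RG.ε⁻¹≈ε (λ c d → R.sym (RG.⁻¹-∙-comm c d))

    coeff-* : ∀ c xs z → coeff (c *ᶠ xs) z R.≈ c R.* coeff xs z
    coeff-* c = coeff-map (c R.*_) (R.zeroʳ c) (R.distribˡ c)

    via : ∀ {xs ys : FormalSum} {f g : B → R.Carrier} →
          (∀ z → coeff xs z R.≈ f z) → (∀ z → coeff ys z R.≈ g z) →
          (∀ z → f z R.≈ g z) → xs ≈ᶠ ys
    via p q r z = R.trans (p z) (R.trans (r z) (R.sym (q z)))

    -inverseˡ : ∀ xs → (-ᶠ xs) ++ xs ≈ᶠ []
    -inverseˡ xs z = R.trans (coeff-++ (-ᶠ xs) xs z)
      (R.trans (R.+-congʳ (coeff-- xs z)) (R.-‿inverseˡ _))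

    ++-comm : ∀ xs ys → xs ++ ys ≈ᶠ ys ++ xs
    ++-comm xs ys = via {xs ++ ys} {ys ++ xs}
      (coeff-++ xs ys) (coeff-++ ys xs) (λ _ → R.+-comm _ _)

  freeModule : Module R (r ⊔ b) (b ⊔ ℓr)
  freeModule = record
    { Carrierᴹ = FormalSum
    ; _≈ᴹ_     = _≈ᶠ_
    ; _+ᴹ_     = _++_
    ; _*ₗ_     = _*ᶠ_
    ; _*ᵣ_     = λ xs c → c *ᶠ xs
    ; 0ᴹ       = []
    ; -ᴹ_      = -ᶠ_
    ; isModule = IsModuleFromLeft.isModule {commutativeRing = R} (record
      { isLeftModule = record
        { isLeftSemimodule = record
          { +ᴹ-isCommutativeMonoid = record
            { isMonoid = record
              { isSemigroup = record
                { isMagma = record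
                  { isEquivalence = record
                    { refl  = λ _ → R.refl
                    ; sym   = λ p z → R.sym (p z)
                    ; trans = λ p q z → R.trans (p z) (q z)
                    }
                  ; ∙-cong = λ {xs} {xs′} {ys} {ys′} p q →
                      via {xs ++ ys} {xs′ ++ ys′} (coeff-++ xs ys) (coeff-++ xs′ ys′)
                        (λ z → R.+-cong (p z) (q z))
                  }
                ; assoc = λ xs ys zs z →
                    R.reflexive (cong (λ t → coeff t z) (List.++-assoc xs ys zs))
                }
              ; identity = (λ _ _ → R.refl)
                         , λ xs z → R.reflexive (cong (λ t → coeff t z) (List.++-identityʳ xs))
              }
            ; comm = ++-comm
            }
          ; isPreleftSemimodule = record
            { *ₗ-cong      = λ {c} {d} {xs} {ys} c≈d p →
                via {c *ᶠ xs} {d *ᶠ ys} (coeff-* c xs) (coeff-* d ys)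
                  (λ z → R.*-cong c≈d (p z))
            ; *ₗ-zeroˡ     = λ xs z → R.trans (coeff-* R.0# xs z) (R.zeroˡ _)
            ; *ₗ-distribʳ  = λ xs c d z → R.trans (coeff-* (c R.+ d) xs z)
                (R.trans (R.distribʳ _ c d)
                  (R.sym (R.trans (coeff-++ (c *ᶠ xs) (d *ᶠ xs) z)
                    (R.+-cong (coeff-* c xs z) (coeff-* d xs z)))))
            ; *ₗ-identityˡ = λ xs z → R.trans (coeff-* R.1# xs z) (R.*-identityˡ _)
            ; *ₗ-assoc     = λ c d xs z → R.trans (coeff-* (c R.* d) xs z)
                (R.trans (R.*-assoc c d _)
                  (R.sym (R.trans (coeff-* c (d *ᶠ xs) z) (R.*-congˡ (coeff-* d xs z)))))
            ; *ₗ-zeroʳ     = λ _ _ → R.refl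
            ; *ₗ-distribˡ  = λ c xs ys z →
                R.reflexive (cong (λ t → coeff t z) (List.map-++ _ xs ys))
            }
          }
        ; -ᴹ‿cong    = λ {xs} {ys} p →
            via { -ᶠ xs} { -ᶠ ys} (coeff-- xs) (coeff-- ys) (λ z → R.-‿cong (p z))
        ; -ᴹ‿inverse = -inverseˡ
                     , λ xs z → R.trans (++-comm xs (-ᶠ xs) z) (-inverseˡ xs z)
        }
      })
    }

  basis : B → FormalSum
  basis x = [ R.1# , x ]

  module LinearExtension {m ℓm} (M : Module R m ℓm) where
    private
      module M = Module M
      module F = Module freeModule
    open ModuleMorphisms F.rawModule M.rawModule using (IsModuleHomomorphism)
    open FiniteSum M

    extend : (B → M.Carrierᴹ) → FormalSum → M.Carrierᴹ
    extend f xs = ∑ xs λ (c , x) → c M.*ₗ f x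

    private
      open ≈-Reasoning M.≈ᴹ-setoid

      ∑-cong : ∀ (L : List B) {f g} → (∀ z → f z M.≈ᴹ g z) → ∑ L f M.≈ᴹ ∑ L g
      ∑-cong []      p = M.≈ᴹ-refl
      ∑-cong (z ∷ L) p = M.+ᴹ-cong (p z) (∑-cong L p)

      ∑-0 : ∀ (L : List B) f → All (λ z → f z M.≈ᴹ M.0ᴹ) L → ∑ L f M.≈ᴹ M.0ᴹ
      ∑-0 []      f []       = M.≈ᴹ-refl
      ∑-0 (z ∷ L) f (p ∷ ps) =
        M.≈ᴹ-trans (M.+ᴹ-cong p (∑-0 L f ps)) (M.+ᴹ-identityˡ _)

      open Algebra.Properties.CommutativeSemigroup
        (CommutativeMonoid.commutativeSemigroup M.+ᴹ-commutativeMonoid)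
        using (interchange; x∙yz≈y∙xz)

      extend-++ : ∀ f xs ys → extend f (xs ++ ys) M.≈ᴹ extend f xs M.+ᴹ extend f ys
      extend-++ f []       ys = M.≈ᴹ-sym (M.+ᴹ-identityˡ _)
      extend-++ f (x ∷ xs) ys =
        M.≈ᴹ-trans (M.+ᴹ-cong M.≈ᴹ-refl (extend-++ f xs ys)) (M.≈ᴹ-sym (M.+ᴹ-assoc _ _ _))

      extend-* : ∀ f c xs → extend f (c F.*ₗ xs) M.≈ᴹ c M.*ₗ extend f xs
      extend-* f c []             = M.≈ᴹ-sym (M.*ₗ-zeroʳ c)
      extend-* f c ((d , x) ∷ xs) =
        M.≈ᴹ-trans (M.+ᴹ-cong (M.*ₗ-assoc c d (f x)) (extend-* f c xs))
                   (M.≈ᴹ-sym (M.*ₗ-distribˡ c _ _))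

      -- Adding a term (c , x) to a formal sum changes only the x-summand.
      ∑-coeff-∷ : ∀ (f : B → M.Carrierᴹ) c x xs L → Unique L → x ∈ L →
        ∑ L (λ z → coeff ((c , x) ∷ xs) z M.*ₗ f z) M.≈ᴹ
        c M.*ₗ f x M.+ᴹ ∑ L (λ z → coeff xs z M.*ₗ f z)
      ∑-coeff-∷ f c x xs (y ∷ L) (y∉L ∷ L!) x∈ with x ≟ y
      ... | yes refl = begin
        (c R.+ coeff xs x) M.*ₗ f x M.+ᴹ ∑ L _
          ≈⟨ M.+ᴹ-cong (M.*ₗ-distribʳ (f x) c _) (rest L y∉L) ⟩
        (c M.*ₗ f x M.+ᴹ coeff xs x M.*ₗ f x) M.+ᴹ ∑ L (λ z → coeff xs z M.*ₗ f z)
          ≈⟨ M.+ᴹ-assoc _ _ _ ⟩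
        c M.*ₗ f x M.+ᴹ (coeff xs x M.*ₗ f x M.+ᴹ ∑ L (λ z → coeff xs z M.*ₗ f z)) ∎
        where
        rest : ∀ L → All (x ≢_) L →
          ∑ L (λ z → coeff ((c , x) ∷ xs) z M.*ₗ f z) M.≈ᴹ
          ∑ L (λ z → coeff xs z M.*ₗ f z)
        rest []      []         = M.≈ᴹ-refl
        rest (z ∷ L) (x≢z ∷ ps) with x ≟ z
        ... | yes x≡z = ⊥-elim (x≢z x≡z)
        ... | no  _   = M.+ᴹ-cong M.≈ᴹ-refl (rest L ps)
      ∑-coeff-∷ f c x xs (y ∷ L) (y∉L ∷ L!) (here x≡y)   | no x≢y = ⊥-elim (x≢y x≡y)
      ∑-coeff-∷ f c x xs (y ∷ L) (y∉L ∷ L!) (there x∈L)  | no x≢y =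
        M.≈ᴹ-trans (M.+ᴹ-cong M.≈ᴹ-refl (∑-coeff-∷ f c x xs L L! x∈L)) (x∙yz≈y∙xz _ _ _)

      extend-coeff : ∀ f xs L → Unique L → All (_∈ L) (map proj₂ xs) →
                     extend f xs M.≈ᴹ ∑ L (λ z → coeff xs z M.*ₗ f z)
      extend-coeff f []             L L! []       =
        M.≈ᴹ-sym (∑-0 L _ (All.tabulate (λ {z} _ → M.*ₗ-zeroˡ (f z))))
      extend-coeff f ((c , x) ∷ xs) L L! (p ∷ ps) =
        M.≈ᴹ-trans (M.+ᴹ-cong M.≈ᴹ-refl (extend-coeff f xs L L! ps))
                   (M.≈ᴹ-sym (∑-coeff-∷ f c x xs L L! p))

      extend-cong : ∀ f {xs ys} → xs ≈ᶠ ys → extend f xs M.≈ᴹ extend f ys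
      extend-cong f {xs} {ys} xs≈ys = begin
        extend f xs                      ≈⟨ extend-coeff f xs L L! (All.tabulate (∈L ∘ ∈-++⁺ˡ)) ⟩
        ∑ L (λ z → coeff xs z M.*ₗ f z)  ≈⟨ ∑-cong L (λ z → M.*ₗ-cong (xs≈ys z) M.≈ᴹ-refl) ⟩
        ∑ L (λ z → coeff ys z M.*ₗ f z)  ≈⟨ extend-coeff f ys L L! (All.tabulate (∈L ∘ ∈-++⁺ʳ _)) ⟨
        extend f ys                      ∎
        where
        support = map proj₂ xs ++ map proj₂ ys
        L  = deduplicate _≟_ support
        L! = deduplicate-! _≟_ support
        ∈L : ∀ {z} → z ∈ support → z ∈ L
        ∈L = ∈-deduplicate⁺ _≟_

    extend-isModuleHomomorphism : ∀ f → IsModuleHomomorphism (extend f)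
    extend-isModuleHomomorphism f = record
      { isBimoduleHomomorphism = record
        { +ᴹ-isGroupHomomorphism = record
          { isMonoidHomomorphism = record
            { isMagmaHomomorphism = record
              { isRelHomomorphism = record
                { cong = λ {xs} {ys} → extend-cong f {xs} {ys} }
              ; homo = extend-++ f
              }
            ; ε-homo = M.≈ᴹ-refl
            }
          ; ⁻¹-homo = λ xs → MG.inverseˡ-unique _ _
              (M.≈ᴹ-trans (M.≈ᴹ-sym (extend-++ f (F.-ᴹ xs) xs))
                (extend-cong f {(F.-ᴹ xs) ++ xs} {[]} (F.-ᴹ‿inverseˡ xs)))
          }
        ; *ₗ-homo = extend-* f
        ; *ᵣ-homo = λ c xs → M.≈ᴹ-trans (extend-* f c xs) (M.*ₗ-*ᵣ-coincident c _)
        }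
      }
      where module MG = Algebra.Properties.AbelianGroup M.+ᴹ-abelianGroup

    extend-basis : ∀ f x → extend f (basis x) M.≈ᴹ f x
    extend-basis f x = M.≈ᴹ-trans (M.+ᴹ-identityʳ _) (M.*ₗ-identityˡ _)

module NSym {c ℓ} (K : Field c ℓ) {a} {A : Set a} {n : ℕ} (finite : A ↔ Fin n) where
  open Field K using (commutativeRing; semiring; -_; 1#)
  open Algebra.Definitions.RawSemiring (Semiring.rawSemiring semiring) using (_^_)

  _≟_ : DecidableEquality (Sentence A)
  _≟_ = List.≡-dec λ v w →
    map′ toList-injective (cong toList) (List.≡-dec (inj⇒≟ (↔⇒↣ finite)) (toList v) (toList w))
    where
    toList-injective : ∀ {v w : Word A} → toList v ≡ toList w → v ≡ w
    toList-injective refl = refl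

  open FreeModule commutativeRing _≟_ public

  NSym : Module commutativeRing _ _
  NSym = freeModule

  open Module NSym public
    renaming (Carrierᴹ to ∣NSym∣) using (_≈ᴹ_; _+ᴹ_; _*ₗ_; 0ᴹ)

  open TensorProduct NSym NSym public using (_⊗_; _≈⊗_)

  NSym⊗NSym : Module commutativeRing _ _
  NSym⊗NSym = TensorProduct.tensorProduct NSym NSym

  open FiniteSum NSym public
  open FiniteSum NSym⊗NSym public renaming (∑ to ∑⊗)
  open LinearExtension

  H : Sentence A → ∣NSym∣
  H = basis

  infixl 7 _·_

  _·_ : ∣NSym∣ → ∣NSym∣ → ∣NSym∣
  x · y = extend NSym (λ I → extend NSym (λ J → H (I ++ J)) y) x

  Δ : ∣NSym∣ → Module.Carrierᴹ NSym⊗NSym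
  Δ = extend NSym⊗NSym λ I →
    ∑⊗ (subsentences I) λ (J , J⊂I) → H ((I ∖ J⊂I) ~) ⊗ H (J ~)

  -- Here ℓ(J) ≤ ∣ I ∣, so the truncated subtraction is exact.
  E : Sentence A → ∣NSym∣
  E I = ∑ (refinements I) λ J → ((- 1#) ^ (∣ I ∣ ∸ length J)) *ₗ H J

-- Replacing H_P ⊗ H_Q by φ P Q for an arbitrary function φ into an abelian group
-- turns E and Δ into signed sums over refinements and over cuts of words, and since
-- φ is arbitrary, the identity for a sentence follows word by word. For a single
-- word x w the refinements pair off: the first block is either x alone or x glued
-- to the first block of a refinement of w, with opposite signs. If the first block
-- goes entirely into Q, both sides satisfy the same recursion in x. If it is cut or
-- goes into P, cancellation leaves only the terms where no letter reaches Q.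

module Submission where

open import Defs
open import Algebra.Bundles using (AbelianGroup; CommutativeRing; Semiring)
open import Algebra.Module.Bundles using (Module)
open import Algebra.Module.Morphism.Structures
  using (module LeftSemimoduleMorphisms; module ModuleMorphisms)
import Algebra.Definitions.RawSemiring
import Algebra.Properties.AbelianGroup
import Algebra.Properties.CommutativeSemigroup
import Algebra.Properties.Semiring.Exp
open import Data.Fin.Base using (Fin)
open import Data.List.Base
  using (List; []; _∷_; [_]; _++_; map; concatMap; foldr; length; take; drop;
         upTo; applyUpTo; cartesianProductWith)
import Data.List.Properties as List
open import Data.List.NonEmpty.Base as List⁺ using (List⁺; _∷_; _∷⁺_; toList)
open import Data.List.Relation.Unary.All as All using (All; []; _∷_)
import Data.List.Relation.Unary.All.Properties as All
import Data.Nat.Base as ℕ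
open import Data.Nat.Base using (ℕ; suc; s≤s; z≤n; _≤_; _∸_)
import Data.Nat.Properties as ℕ
open import Data.Product.Base using (_×_; _,_)
open import Function.Base using (_∘_)
open import Function.Bundles using (_↔_)
open import Level using (Level; _⊔_)
open import Relation.Binary.PropositionalEquality as ≡ using (_≡_; cong; cong₂)
import Relation.Binary.Reasoning.Setoid as ≈-Reasoning

private
  variable
    a b : Level
    A : Set a
    X : Set b

∷-~ : (v : List A) (J : WeakSentence A) → (v ∷ J) ~ ≡ ⟨ v ⟩ ++ J ~
∷-~ []      J = ≡.refl
∷-~ (_ ∷ _) J = ≡.refl

-- The value at the empty sentence is junk.
extendFirst : A → Sentence A → Sentence A
extendFirst x []      = [ List⁺.[ x ] ]
extendFirst x (v ∷ I) = (x ∷⁺ v) ∷ I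

-- Finite sums in an abelian group and additive functionals

module GroupSums {g ℓ} (𝔾 : AbelianGroup g ℓ) where
  open AbelianGroup 𝔾
    renaming (_∙_ to _+_; ε to 0#; _⁻¹ to -_; ∙-cong to +-cong; ∙-congˡ to +-congˡ;
              assoc to +-assoc; identityˡ to +-identityˡ; identityʳ to +-identityʳ;
              inverseʳ to -‿inverseʳ)
  open Algebra.Properties.AbelianGroup 𝔾 using (inverseʳ-unique; ∙-cancelˡ)
  open Algebra.Properties.CommutativeSemigroup commutativeSemigroup using (interchange)
  open ≈-Reasoning setoid

  ∑ : List X → (X → Carrier) → Carrier
  ∑ xs f = foldr _+_ 0# (map f xs)

  ∑-congᴬ : ∀ {f g : X → Carrier} {xs} → All (λ x → f x ≈ g x) xs → ∑ xs f ≈ ∑ xs g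
  ∑-congᴬ []       = refl
  ∑-congᴬ (p ∷ ps) = +-cong p (∑-congᴬ ps)

  ∑-cong : ∀ {f g : X → Carrier} xs → (∀ x → f x ≈ g x) → ∑ xs f ≈ ∑ xs g
  ∑-cong xs f≈g = ∑-congᴬ (All.universal f≈g xs)

  ∑-map : ∀ {c} {C : Set c} (h : X → C) (f : C → Carrier) xs → ∑ (map h xs) f ≡ ∑ xs (f ∘ h)
  ∑-map h f xs = cong (foldr _+_ 0#) (≡.sym (List.map-∘ xs))

  ∑-++ : ∀ (f : X → Carrier) xs ys → ∑ (xs ++ ys) f ≈ ∑ xs f + ∑ ys f
  ∑-++ f []       ys = sym (+-identityˡ _)
  ∑-++ f (x ∷ xs) ys = trans (+-congˡ (∑-++ f xs ys)) (sym (+-assoc _ _ _))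

  ∑-cartesianProductWith :
    ∀ {c d} {C : Set c} {D : Set d} (h : X → C → D) (f : D → Carrier) xs ys →
    ∑ (cartesianProductWith h xs ys) f ≈ ∑ xs (λ x → ∑ ys λ y → f (h x y))
  ∑-cartesianProductWith h f []       ys = refl
  ∑-cartesianProductWith h f (x ∷ xs) ys = trans (∑-++ f (map (h x) ys) _)
    (+-cong (reflexive (∑-map (h x) f ys)) (∑-cartesianProductWith h f xs ys))

  -- A common interface for `∑`, `altBlocks`, `altWord` and `alt`, so that a single set of
  -- interchange lemmas serves them all. Compatibility with zero and negation follows from
  -- additivity by cancellation in the group.
  record Additive {b} {X : Set b} (T : (X → Carrier) → Carrier) : Set (b ⊔ g ⊔ ℓ) where
    field
      T-cong : ∀ {f g} → (∀ x → f x ≈ g x) → T f ≈ T g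
      T-+    : ∀ f g → T (λ x → f x + g x) ≈ T f + T g

    T-0 : T (λ _ → 0#) ≈ 0#
    T-0 = ∙-cancelˡ _ _ _ (trans (sym (T-+ _ _))
      (trans (T-cong λ _ → +-identityˡ 0#) (sym (+-identityʳ _))))

    T-neg : ∀ f → T (λ x → - f x) ≈ - T f
    T-neg f = inverseʳ-unique _ _ (trans (sym (T-+ _ _))
      (trans (T-cong λ x → -‿inverseʳ (f x)) T-0))

    T-∑ : ∀ {c} {C : Set c} (f : X → C → Carrier) ys →
          T (λ x → ∑ ys (f x)) ≈ ∑ ys (λ y → T (λ x → f x y))
    T-∑ f []       = T-0
    T-∑ f (y ∷ ys) = trans (T-+ _ _) (+-congˡ (T-∑ f ys))

  ∑-additive : ∀ (xs : List X) → Additive (∑ xs)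
  ∑-additive xs = record { T-cong = ∑-cong xs ; T-+ = go xs }
    where
    go : ∀ xs f g → ∑ xs (λ x → f x + g x) ≈ ∑ xs f + ∑ xs g
    go []       f g = sym (+-identityˡ 0#)
    go (x ∷ xs) f g = trans (+-congˡ (go xs f g)) (interchange _ _ _ _)

-- Alternating sums over refinements

module AlternatingSums {a} (A : Set a) {g ℓ} (𝔾 : AbelianGroup g ℓ) where
  open AbelianGroup 𝔾
    renaming (_∙_ to _+_; ε to 0#; _⁻¹ to -_; ∙-cong to +-cong; ∙-congˡ to +-congˡ;
              ∙-congʳ to +-congʳ; assoc to +-assoc; comm to +-comm;
              identityʳ to +-identityʳ; ⁻¹-cong to -‿cong)
  open Algebra.Properties.AbelianGroup 𝔾 using (⁻¹-∙-comm; xyx⁻¹≈y)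
  open Algebra.Properties.CommutativeSemigroup commutativeSemigroup using (interchange)
  open ≈-Reasoning setoid
  open GroupSums 𝔾
  open Additive

  -- The sum of f over the factorizations of x ∷ w into blocks, with sign
  -- (-1)^(number of letters − number of blocks).
  altBlocks : A → List A → (List⁺ (Word A) → Carrier) → Carrier
  altBlocks x []      f = f List⁺.[ List⁺.[ x ] ]
  altBlocks x (y ∷ w) f =
    altBlocks y w (f ∘ (List⁺.[ x ] ∷⁺_)) + - altBlocks y w (f ∘ extendHead x)

  -- A piece of a cut word may be empty and then contributes the empty sentence, in accordance with
  -- `E [] ≈ 1`.
  altWord : List A → (Sentence A → Carrier) → Carrier
  altWord []      f = f []
  altWord (x ∷ w) f = altBlocks x w (f ∘ toList)

  alt : Sentence A → (Sentence A → Carrier) → Carrier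
  alt []      f = f []
  alt ((x ∷ w) ∷ I) f = altBlocks x w λ G → alt I λ J → f (toList G ++ J)

  altBlocks-additive : ∀ x w → Additive (altBlocks x w)
  altBlocks-additive x []      = record { T-cong = λ f≈g → f≈g _ ; T-+ = λ _ _ → refl }
  altBlocks-additive x (y ∷ w) = record
    { T-cong = λ f≈g → +-cong (T-cong B (f≈g ∘ _)) (-‿cong (T-cong B (f≈g ∘ _)))
    ; T-+    = λ f g → trans
        (+-cong (T-+ B _ _) (trans (-‿cong (T-+ B _ _)) (sym (⁻¹-∙-comm _ _))))
        (interchange _ _ _ _)
    }
    where B = altBlocks-additive y w

  altWord-additive : ∀ w → Additive (altWord w)
  altWord-additive []      = record { T-cong = λ f≈g → f≈g _ ; T-+ = λ _ _ → refl }
  altWord-additive (x ∷ w) = record { T-cong = λ f≈g → T-cong B (f≈g ∘ _) ; T-+ = λ _ _ → T-+ B _ _ }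
    where B = altBlocks-additive x w

  alt-additive : ∀ I → Additive (alt I)
  alt-additive []      = record { T-cong = λ f≈g → f≈g _ ; T-+ = λ _ _ → refl }
  alt-additive ((x ∷ w) ∷ I) = record
    { T-cong = λ f≈g → T-cong B λ _ → T-cong (alt-additive I) λ _ → f≈g _
    ; T-+    = λ f g → trans (T-cong B λ _ → T-+ (alt-additive I) _ _) (T-+ B _ _)
    }
    where B = altBlocks-additive x w

  module _ {T : (X → Carrier) → Carrier} (T-add : Additive T) where

    -- `altBlocks` combines evaluations by addition and negation, and `T` commutes with both. This
    -- is what lets sums attached to different pieces of a sentence change places in `alt-split`.
    altBlocks-comm : ∀ x w (f : X → List⁺ (Word A) → Carrier) →
      T (λ z → altBlocks x w (f z)) ≈ altBlocks x w (λ G → T λ z → f z G)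
    altBlocks-comm x []      f = refl
    altBlocks-comm x (y ∷ w) f = trans (T-+ T-add _ _)
      (+-cong (altBlocks-comm y w _) (trans (T-neg T-add _) (-‿cong (altBlocks-comm y w _))))

    altWord-comm : ∀ w (f : X → Sentence A → Carrier) →
      T (λ z → altWord w (f z)) ≈ altWord w (λ J → T λ z → f z J)
    altWord-comm []      f = refl
    altWord-comm (x ∷ w) f = altBlocks-comm x w _

  alt-⟨⟩-++ : ∀ u I f → alt (⟨ u ⟩ ++ I) f ≈ altWord u (λ P → alt I λ J → f (P ++ J))
  alt-⟨⟩-++ []      I f = refl
  alt-⟨⟩-++ (_ ∷ _) I f = refl

  -- Sums over the cuts of a sentence and of its first block

  split : Sentence A → (Sentence A → Sentence A → Carrier) → Carrier
  split I φ = ∑ (subsentences I) λ (J , J⊂I) → φ ((I ∖ J⊂I) ~) (J ~)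

  split-cong : ∀ I {φ ψ} → (∀ P Q → φ P Q ≈ ψ P Q) → split I φ ≈ split I ψ
  split-cong I φ≈ψ = ∑-cong (subsentences I) λ _ → φ≈ψ _ _

  split-∷ : ∀ w I φ → split (w ∷ I) φ ≈
    ∑ (suffixes (toList w)) λ (v , u , _) → split I λ P Q → φ (⟨ u ⟩ ++ P) (⟨ v ⟩ ++ Q)
  split-∷ w I φ = trans (∑-cartesianProductWith _∷ˢ_ _ (suffixes (toList w)) (subsentences I))
    (∑-cong (suffixes (toList w)) λ (v , u , _) → ∑-cong (subsentences I) λ (J , J⊂I) →
      reflexive (cong₂ φ (∷-~ u (I ∖ J⊂I)) (∷-~ v J)))

  -- The terms of `split` are sorted by the prefix taken from the first block: empty in
  -- `splitWhole`, non-empty in `splitCut`. In `splitCut` the remaining suffix `v` may be empty.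
  splitWhole splitCut : List⁺ (Word A) → (Sentence A → Sentence A → Carrier) → Carrier
  splitWhole (v ∷ I) φ = split I λ P Q → φ P (v ∷ Q)
  splitCut ((x ∷ w) ∷ I) φ =
    ∑ (suffixes w) λ (v , u , _) → split I λ P Q → φ ((x ∷ u) ∷ P) (⟨ v ⟩ ++ Q)

  ∑-suffixes-∷ : ∀ x w (f : List A → List A → Carrier) →
    ∑ (suffixes (x ∷ w)) (λ (v , u , _) → f v u) ≈
    f (x ∷ w) [] + ∑ (suffixes w) (λ (v , u , _) → f v (x ∷ u))
  ∑-suffixes-∷ x w f = +-congˡ (reflexive (∑-map _ _ (suffixes w)))

  split-first : ∀ G φ → split (toList G) φ ≈ splitWhole G φ + splitCut G φ
  split-first (w@(x ∷ v) ∷ I) φ = trans (split-∷ w I φ) (∑-suffixes-∷ x v _)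

  splitCut-[]∷ : ∀ x G φ →
    splitCut (List⁺.[ x ] ∷⁺ G) φ ≈ split (toList G) (φ ∘ (List⁺.[ x ] ∷_))
  splitCut-[]∷ x G φ = +-identityʳ _

  -- A non-empty prefix of the enlarged block is either `x` alone, and then the old first block
  -- passes whole to the second argument, or `x` followed by a non-empty prefix of the old block.
  splitCut-extendHead : ∀ x G φ → splitCut (extendHead x G) φ ≈
    splitWhole G (φ ∘ (List⁺.[ x ] ∷_)) + splitCut G (φ ∘ extendFirst x)
  splitCut-extendHead x ((y ∷ w) ∷ I) φ = ∑-suffixes-∷ y w _

  -- The identity for a single word

  -- Two constructions give the same pair with opposite signs: `x` is a block by itself and the next
  -- block stays whole, or `x` is glued to that block and then cut off again right after `x`. After
  -- they cancel, the remaining terms have the same form for the shorter word, and at the last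
  -- letter nothing is left for the second argument.
  altBlocks-splitCut : ∀ x w φ →
    altBlocks x w (λ G → splitCut G φ) ≈ altBlocks x w (λ G → φ (toList G) [])
  altBlocks-splitCut x []      φ = trans (+-identityʳ _) (+-identityʳ _)
  altBlocks-splitCut x (y ∷ w) φ = begin
    B (λ G → splitCut (List⁺.[ x ] ∷⁺ G) φ) + - B (λ G → splitCut (extendHead x G) φ)
      ≈⟨ +-cong
           (trans (T-cong B+ λ G → trans (splitCut-[]∷ x G φ) (split-first G φˣ)) (T-+ B+ _ _))
           (-‿cong (trans (T-cong B+ λ G → splitCut-extendHead x G φ) (T-+ B+ _ _))) ⟩
    (B (λ G → splitWhole G φˣ) + B (λ G → splitCut G φˣ)) +
      - (B (λ G → splitWhole G φˣ) + B (λ G → splitCut G φᵉ))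
      ≈⟨ cancel _ _ _ ⟩
    B (λ G → splitCut G φˣ) + - B (λ G → splitCut G φᵉ)
      ≈⟨ +-cong (altBlocks-splitCut y w φˣ) (-‿cong (altBlocks-splitCut y w φᵉ)) ⟩
    B (λ G → φˣ (toList G) []) + - B (λ G → φᵉ (toList G) []) ∎
    where
    B  = altBlocks y w
    B+ = altBlocks-additive y w
    φˣ φᵉ : Sentence A → Sentence A → Carrier
    φˣ = φ ∘ (List⁺.[ x ] ∷_)
    φᵉ = φ ∘ extendFirst x
    cancel : ∀ p q r → (p + q) + - (p + r) ≈ q + - r
    cancel p q r = begin
      (p + q) + - (p + r)    ≈⟨ +-congˡ (⁻¹-∙-comm p r) ⟨
      (p + q) + (- p + - r)  ≈⟨ +-assoc _ _ _ ⟨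
      ((p + q) + - p) + - r  ≈⟨ +-congʳ (xyx⁻¹≈y p q) ⟩
      q + - r                ∎

  -- Now `x` always lies in the second argument, either as a block of its own (`φˣ`) or glued to a
  -- whole first block (`φᵉ`). These are the two terms by which `altWord (x ∷ y ∷ u)` unfolds, so
  -- the induction closes once the `splitCut` terms are evaluated.
  altBlocks-splitWhole : ∀ x w φ → altBlocks x w (λ G → splitWhole G φ) ≈
    ∑ (suffixes w) λ (v , u , _) → altWord v λ P → altWord (x ∷ u) (φ P)
  altBlocks-splitWhole x []      φ = refl
  altBlocks-splitWhole x (y ∷ w) φ = begin
    B (λ G → split (toList G) φˣ) + - B (λ G → splitWhole G φᵉ)
      ≈⟨ +-congʳ (trans (T-cong B+ λ G → split-first G φˣ) (T-+ B+ _ _)) ⟩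
    (B (λ G → splitWhole G φˣ) + B (λ G → splitCut G φˣ)) + - B (λ G → splitWhole G φᵉ)
      ≈⟨ +-cong (+-cong (altBlocks-splitWhole y w φˣ) (altBlocks-splitCut y w φˣ))
                (-‿cong (altBlocks-splitWhole y w φᵉ)) ⟩
    (R φˣ + B (λ G → φˣ (toList G) [])) + - R φᵉ
      ≈⟨ trans (+-congʳ (+-comm _ _)) (+-assoc _ _ _) ⟩
    -- The first summand comes from `splitCut`: all of `y ∷ w` is in the first argument and only `x`
    -- in the second. It is the term of the target sum with `u` empty.
    B (λ G → φˣ (toList G) []) + (R φˣ + - R φᵉ)
      ≈⟨ +-congˡ (trans (T-+ ∑+ _ _) (+-congˡ (T-neg ∑+ _))) ⟨
    B (λ G → φˣ (toList G) []) + ∑ (suffixes w) (λ (v , u , _) →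
      altWord v (λ P → altWord (y ∷ u) (φˣ P)) + - altWord v (λ P → altWord (y ∷ u) (φᵉ P)))
      ≈⟨ +-congˡ (T-cong ∑+ λ (v , u , _) →
           trans (T-+ (altWord-additive v) _ _) (+-congˡ (T-neg (altWord-additive v) _))) ⟨
    B (λ G → φˣ (toList G) []) +
      ∑ (suffixes w) (λ (v , u , _) → altWord v λ P → altWord (x ∷ y ∷ u) (φ P))
      ≈⟨ ∑-suffixes-∷ y w _ ⟨
    ∑ (suffixes (y ∷ w)) (λ (v , u , _) → altWord v λ P → altWord (x ∷ u) (φ P)) ∎
    where
    B  = altBlocks y w
    B+ = altBlocks-additive y w
    ∑+ = ∑-additive (suffixes w)
    φˣ φᵉ : Sentence A → Sentence A → Carrier
    φˣ P = φ P ∘ (List⁺.[ x ] ∷_)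
    φᵉ P = φ P ∘ extendFirst x
    R : (Sentence A → Sentence A → Carrier) → Carrier
    R ψ = ∑ (suffixes w) λ (v , u , _) → altWord v λ P → altWord (y ∷ u) (ψ P)

  -- The `splitCut` terms account for the cut with empty `u`, the `splitWhole` terms for those with
  -- non-empty `u`. The sides change here: `split` sends prefixes to the first argument, whereas on
  -- the right the prefix `u` feeds the second.
  altWord-split : ∀ w φ → altWord w (λ J → split J φ) ≈
    ∑ (suffixes w) λ (v , u , _) → altWord v λ P → altWord u (φ P)
  altWord-split []      φ = refl
  altWord-split (x ∷ w) φ = begin
    B (λ G → split (toList G) φ)
      ≈⟨ trans (T-cong B+ λ G → split-first G φ) (T-+ B+ _ _) ⟩
    B (λ G → splitWhole G φ) + B (λ G → splitCut G φ)
      ≈⟨ trans (+-comm _ _) (+-cong (altBlocks-splitCut x w φ) (altBlocks-splitWhole x w φ)) ⟩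
    B (λ G → φ (toList G) []) +
      ∑ (suffixes w) (λ (v , u , _) → altWord v λ P → altWord (x ∷ u) (φ P))
      ≈⟨ ∑-suffixes-∷ x w _ ⟨
    ∑ (suffixes (x ∷ w)) (λ (v , u , _) → altWord v λ P → altWord u (φ P)) ∎
    where
    B  = altBlocks x w
    B+ = altBlocks-additive x w

  -- From words to sentences

  -- Cuts of the two parts are chosen independently; for `φ P Q = H P ⊗ H Q` this expresses the
  -- multiplicativity of the coproduct on basis elements.
  split-++ : ∀ I J φ →
    split (I ++ J) φ ≈ split I λ P Q → split J λ P′ Q′ → φ (P ++ P′) (Q ++ Q′)
  split-++ []      J φ = sym (+-identityʳ _)
  split-++ (w ∷ I) J φ = begin
    split (w ∷ I ++ J) φ
      ≈⟨ split-∷ w (I ++ J) φ ⟩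
    ∑ (suffixes (toList w)) (λ (v , u , _) →
      split (I ++ J) λ P Q → φ (⟨ u ⟩ ++ P) (⟨ v ⟩ ++ Q))
      ≈⟨ ∑-cong (suffixes (toList w)) (λ (v , u , _) → trans
           (split-++ I J λ P Q → φ (⟨ u ⟩ ++ P) (⟨ v ⟩ ++ Q))
           (split-cong I λ P Q → split-cong J λ P′ Q′ → reflexive
             (cong₂ φ (≡.sym (List.++-assoc ⟨ u ⟩ P P′)) (≡.sym (List.++-assoc ⟨ v ⟩ Q Q′))))) ⟩
    ∑ (suffixes (toList w)) (λ (v , u , _) → split I λ P Q → split J λ P′ Q′ →
      φ ((⟨ u ⟩ ++ P) ++ P′) ((⟨ v ⟩ ++ Q) ++ Q′))
      ≈⟨ split-∷ w I (λ P Q → split J λ P′ Q′ → φ (P ++ P′) (Q ++ Q′)) ⟨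
    split (w ∷ I) (λ P Q → split J λ P′ Q′ → φ (P ++ P′) (Q ++ Q′)) ∎

  -- Induction on the words of `I`: `split-++` separates the blocks of the first word from the rest,
  -- the rest is handled by induction, and `altWord-split` treats the first word with the result `ψ`
  -- as its test function.
  alt-split : ∀ I φ → alt I (λ J → split J φ) ≈ split I λ U V → alt V λ P → alt U (φ P)
  alt-split []      φ = refl
  alt-split (w@(x ∷ v) ∷ I) φ = begin
    altBlocks x v (λ G → alt I λ J → split (toList G ++ J) φ)
      ≈⟨ T-cong (altBlocks-additive x v) (λ G → begin
           alt I (λ J → split (toList G ++ J) φ)
             ≈⟨ T-cong (alt-additive I) (λ J → split-++ (toList G) J φ) ⟩
           alt I (λ J → split (toList G) λ P Q → split J (φ++ P Q))
             ≈⟨ T-∑ (alt-additive I) _ (subsentences (toList G)) ⟩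
           split (toList G) (λ P Q → alt I λ J → split J (φ++ P Q))
             -- The induction hypothesis is applied to `φ++ P Q`, which already contains the pieces
             -- of the first word.
             ≈⟨ split-cong (toList G) (λ P Q → alt-split I (φ++ P Q)) ⟩
           split (toList G) ψ ∎) ⟩
    altWord (toList w) (λ G → split G ψ)
      ≈⟨ altWord-split (toList w) ψ ⟩
    ∑ (suffixes (toList w)) (λ (v , u , _) → altWord v λ P → altWord u (ψ P))
      ≈⟨ ∑-cong (suffixes (toList w)) (λ (v , u , _) → regroup v u) ⟨
    ∑ (suffixes (toList w)) (λ (v , u , _) → split I λ U V →
      alt (⟨ v ⟩ ++ V) λ P → alt (⟨ u ⟩ ++ U) (φ P))
      ≈⟨ split-∷ w I (λ U V → alt V λ P → alt U (φ P)) ⟨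
    split (w ∷ I) (λ U V → alt V λ P → alt U (φ P)) ∎
    where
    φ++ : Sentence A → Sentence A → Sentence A → Sentence A → Carrier
    φ++ P Q P′ Q′ = φ (P ++ P′) (Q ++ Q′)

    ψ : Sentence A → Sentence A → Carrier
    ψ P Q = split I λ U V → alt V λ P′ → alt U (φ++ P Q P′)

    regroup : ∀ v u →
      split I (λ U V → alt (⟨ v ⟩ ++ V) λ P → alt (⟨ u ⟩ ++ U) (φ P)) ≈
      altWord v (λ P → altWord u (ψ P))
    regroup v u = begin
      split I (λ U V → alt (⟨ v ⟩ ++ V) λ P → alt (⟨ u ⟩ ++ U) (φ P))
        ≈⟨ split-cong I (λ U V → trans (alt-⟨⟩-++ v V (λ P → alt (⟨ u ⟩ ++ U) (φ P)))
             (T-cong (altWord-additive v) λ P →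
               trans (T-cong (alt-additive V) λ P′ → alt-⟨⟩-++ u U (φ (P ++ P′)))
                     (altWord-comm (alt-additive V) u _))) ⟩
      split I (λ U V → altWord v λ P → altWord u λ Q → alt V λ P′ → alt U (φ++ P Q P′))
        ≈⟨ T-∑ (altWord-additive v) _ (subsentences I) ⟨
      altWord v (λ P → split I λ U V → altWord u λ Q → alt V λ P′ → alt U (φ++ P Q P′))
        ≈⟨ T-cong (altWord-additive v) (λ P → T-∑ (altWord-additive u) _ (subsentences I)) ⟨
      altWord v (λ P → altWord u (ψ P)) ∎

-- Length bounds for the exponents of the signs

blocks-length : ∀ (x : A) w → All (λ G → List⁺.length G ≤ suc (length w)) (blocks x w)
blocks-length x []      = s≤s z≤n ∷ []
blocks-length x (y ∷ w) = All.++⁺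
  (All.map⁺ (All.map s≤s (blocks-length y w)))
  (All.map⁺ (All.map ℕ.m≤n⇒m≤1+n (blocks-length y w)))

length-concat : (I : List⁺ (Word A)) → List⁺.length I ≤ List⁺.length (List⁺.concat I)
length-concat ((x ∷ w) ∷ I) = s≤s (go w I)
  where
  go : ∀ w (I : Sentence A) → length I ≤ length (w ++ concatMap toList I)
  go w []            = z≤n
  go w ((x ∷ v) ∷ I) = ℕ.≤-trans (ℕ.≤-trans (s≤s (go v I)) (ℕ.m≤n+m _ (length w)))
    (ℕ.≤-reflexive (≡.sym (List.length-++ w)))

≼⇒length≤∣∣ : {J I : Sentence A} → J ≼ I → length J ≤ ∣ I ∣
≼⇒length≤∣∣ (Gs , ≡.refl , ≡.refl) = go Gs
  where
  go : ∀ (Gs : List (List⁺ (Word A))) → length (concatMap toList Gs) ≤ ∣ map List⁺.concat Gs ∣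
  go []       = z≤n
  go (G ∷ Gs) = ℕ.≤-trans (ℕ.≤-reflexive (List.length-++ (toList G)))
    (ℕ.+-mono-≤ (length-concat G) (go Gs))

-- Under these bounds both subtractions are exact, so the exponent of the sign is additive over the
-- first word and the remaining sentence.
[m+n]∸[o+p]≡[m∸o]+[n∸p] : ∀ {m n o p} → o ≤ m → p ≤ n →
                          (m ℕ.+ n) ∸ (o ℕ.+ p) ≡ (m ∸ o) ℕ.+ (n ∸ p)
[m+n]∸[o+p]≡[m∸o]+[n∸p] {m} {n} {o} {p} o≤m p≤n = begin
  (m ℕ.+ n) ∸ (o ℕ.+ p)  ≡⟨ ℕ.∸-+-assoc (m ℕ.+ n) o p ⟨
  (m ℕ.+ n) ∸ o ∸ p      ≡⟨ cong (_∸ p) (ℕ.+-∸-comm n o≤m) ⟩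
  (m ∸ o) ℕ.+ n ∸ p      ≡⟨ ℕ.+-∸-assoc (m ∸ o) p≤n ⟩
  (m ∸ o) ℕ.+ (n ∸ p)    ∎
  where open ≡.≡-Reasoning

-- Signed sums over refinements in a module

module SignedSums {a} (A : Set a) {r ℓr m ℓm} {R : CommutativeRing r ℓr} (M : Module R m ℓm) where
  private
    module R = CommutativeRing R
    module M = Module M
  open M using (_*ₗ_; -ᴹ_; _+ᴹ_; 0ᴹ)
    renaming (Carrierᴹ to Carrier; _≈ᴹ_ to _≈_; ≈ᴹ-refl to refl; ≈ᴹ-trans to trans;
              ≈ᴹ-reflexive to reflexive; ≈ᴹ-setoid to setoid)
  open Algebra.Properties.AbelianGroup M.+ᴹ-abelianGroup using (inverseˡ-unique)
  open Algebra.Definitions.RawSemiring (Semiring.rawSemiring R.semiring) using (_^_)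
  open Algebra.Properties.Semiring.Exp R.semiring using (^-homo-*)
  open ≈-Reasoning setoid
  open GroupSums M.+ᴹ-abelianGroup
  open Additive
  open AlternatingSums A M.+ᴹ-abelianGroup using (alt; altBlocks)

  -1*ₗ : ∀ x → (R.- R.1#) *ₗ x ≈ -ᴹ x
  -1*ₗ x = inverseˡ-unique _ _ (begin
    (R.- R.1#) *ₗ x +ᴹ x            ≈⟨ M.+ᴹ-congˡ (M.*ₗ-identityˡ x) ⟨
    (R.- R.1#) *ₗ x +ᴹ R.1# *ₗ x    ≈⟨ M.*ₗ-distribʳ x _ _ ⟨
    ((R.- R.1#) R.+ R.1#) *ₗ x      ≈⟨ M.*ₗ-cong (R.-‿inverseˡ R.1#) refl ⟩
    R.0# *ₗ x                       ≈⟨ M.*ₗ-zeroˡ x ⟩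
    0ᴹ                              ∎)

  *ₗ-∑ : ∀ c (f : X → Carrier) xs → c *ₗ ∑ xs f ≈ ∑ xs (λ x → c *ₗ f x)
  *ₗ-∑ c f []       = M.*ₗ-zeroʳ c
  *ₗ-∑ c f (x ∷ xs) = trans (M.*ₗ-distribˡ c _ _) (M.+ᴹ-congˡ (*ₗ-∑ c f xs))

  sign : ℕ → Carrier → Carrier
  sign k x = ((R.- R.1#) ^ k) *ₗ x

  sign-cong : ∀ k {x y} → x ≈ y → sign k x ≈ sign k y
  sign-cong k = M.*ₗ-cong R.refl

  sign-suc : ∀ k x → sign (suc k) x ≈ -ᴹ sign k x
  sign-suc k x = trans (M.*ₗ-assoc _ _ x) (-1*ₗ _)

  sign-+ : ∀ k l x → sign (k ℕ.+ l) x ≈ sign k (sign l x)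
  sign-+ k l x = trans (M.*ₗ-cong (^-homo-* (R.- R.1#) k l) refl) (M.*ₗ-assoc _ _ x)

  -- Putting `x` in a block of its own adds one letter and one block, and the exponent does not
  -- change. Gluing `x` to the first block adds a letter only, which gives one more factor -1.
  ∑-blocks : ∀ (x : A) w (f : List⁺ (Word A) → Carrier) →
    ∑ (blocks x w) (λ G → sign (suc (length w) ∸ List⁺.length G) (f G)) ≈ altBlocks x w f
  ∑-blocks x []      f = trans (M.+ᴹ-identityʳ _) (M.*ₗ-identityˡ _)
  ∑-blocks x (y ∷ w) f = begin
    ∑ (map (List⁺.[ x ] ∷⁺_) (blocks y w) ++ map (extendHead x) (blocks y w)) F
      ≈⟨ ∑-++ F (map (List⁺.[ x ] ∷⁺_) (blocks y w)) _ ⟩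
    ∑ (map (List⁺.[ x ] ∷⁺_) (blocks y w)) F +ᴹ ∑ (map (extendHead x) (blocks y w)) F
      ≈⟨ M.+ᴹ-cong (reflexive (∑-map (List⁺.[ x ] ∷⁺_) F (blocks y w)))
                   (reflexive (∑-map (extendHead x) F (blocks y w))) ⟩
    ∑ (blocks y w) (F ∘ (List⁺.[ x ] ∷⁺_)) +ᴹ ∑ (blocks y w) (F ∘ extendHead x)
      ≈⟨ M.+ᴹ-congˡ (∑-congᴬ (All.map sign-extendHead (blocks-length y w))) ⟩
    ∑ (blocks y w) (F ∘ (List⁺.[ x ] ∷⁺_)) +ᴹ ∑ (blocks y w) (λ G → -ᴹ F′ G)
      ≈⟨ M.+ᴹ-cong (∑-blocks y w (f ∘ (List⁺.[ x ] ∷⁺_)))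
           (trans (T-neg (∑-additive (blocks y w)) F′) (M.-ᴹ‿cong (∑-blocks y w _))) ⟩
    altBlocks x (y ∷ w) f ∎
    where
    F F′ : List⁺ (Word A) → Carrier
    F  G = sign (suc (suc (length w)) ∸ List⁺.length G) (f G)
    F′ G = sign (suc (length w) ∸ List⁺.length G) (f (extendHead x G))
    sign-extendHead : ∀ {G} → List⁺.length G ≤ suc (length w) → F (extendHead x G) ≈ -ᴹ F′ G
    sign-extendHead {G} le = trans
      (reflexive (cong (λ k → sign k (f (extendHead x G))) (ℕ.+-∸-assoc 1 le)))
      (sign-suc (suc (length w) ∸ List⁺.length G) _)

  -- The bridge from powers of -1 as scalars to the recursive `alt`, whose signs are negations in
  -- the underlying abelian group.
  ∑-refinements : ∀ (I : Sentence A) (f : Sentence A → Carrier) →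
    ∑ (refinements I) (λ J → sign (∣ I ∣ ∸ length J) (f J)) ≈ alt I f
  ∑-refinements []                f = trans (M.+ᴹ-identityʳ _) (M.*ₗ-identityˡ _)
  ∑-refinements I′@((x ∷ w) ∷ I) f = begin
    ∑ (refinements I′) F
      ≈⟨ reflexive (∑-map (concatMap toList) F (groupings I′)) ⟩
    ∑ (groupings I′) (F ∘ concatMap toList)
      ≈⟨ ∑-cartesianProductWith _∷_ _ (blocks x w) (groupings I) ⟩
    ∑ (blocks x w) (λ G → ∑ (groupings I) λ Gs → F (toList G ++ concatMap toList Gs))
      ≈⟨ ∑-cong (blocks x w) (λ G → reflexive
           (≡.sym (∑-map (concatMap toList) (λ J → F (toList G ++ J)) (groupings I)))) ⟩
    ∑ (blocks x w) (λ G → ∑ (refinements I) λ J → F (toList G ++ J))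
      -- The sign is factored only for the listed `G` and `J`, since the length bounds come from
      -- their membership in the lists.
      ≈⟨ ∑-congᴬ (All.map (λ {G} G≤ → ∑-congᴬ (All.map
           (λ {J} J≼I → factor G J G≤ (≼⇒length≤∣∣ J≼I)) (refinements-sound I))) (blocks-length x w)) ⟩
    ∑ (blocks x w) (λ G → ∑ (refinements I) λ J →
      sign (suc (length w) ∸ List⁺.length G) (sign (∣ I ∣ ∸ length J) (f (toList G ++ J))))
      ≈⟨ ∑-cong (blocks x w) (λ G → *ₗ-∑ _ _ (refinements I)) ⟨
    ∑ (blocks x w) (λ G → sign (suc (length w) ∸ List⁺.length G)
      (∑ (refinements I) λ J → sign (∣ I ∣ ∸ length J) (f (toList G ++ J))))
      ≈⟨ ∑-cong (blocks x w) (λ G → sign-cong (suc (length w) ∸ List⁺.length G)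
           (∑-refinements I λ J → f (toList G ++ J))) ⟩
    ∑ (blocks x w) (λ G → sign (suc (length w) ∸ List⁺.length G) (alt I λ J → f (toList G ++ J)))
      ≈⟨ ∑-blocks x w _ ⟩
    alt I′ f ∎
    where
    F : Sentence A → Carrier
    F J = sign (∣ I′ ∣ ∸ length J) (f J)
    factor : ∀ G J → List⁺.length G ≤ suc (length w) → length J ≤ ∣ I ∣ →
      F (toList G ++ J) ≈
      sign (suc (length w) ∸ List⁺.length G) (sign (∣ I ∣ ∸ length J) (f (toList G ++ J)))
    factor G J G≤ J≤ = trans
      (reflexive (cong (λ k → sign k (f (toList G ++ J))) (≡.trans
        (cong (∣ I′ ∣ ∸_) (List.length-++ (toList G)))
        ([m+n]∸[o+p]≡[m∸o]+[n∸p] G≤ J≤))))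
      (sign-+ (suc (length w) ∸ List⁺.length G) (∣ I ∣ ∸ length J) _)

-- Linear maps, and cuts of a word indexed by position

module LinearMaps {r ℓr m ℓm n ℓn} {R : CommutativeRing r ℓr}
                  (M : Module R m ℓm) (N : Module R n ℓn) where
  private
    module M = Module M
    module N = Module N
  open LeftSemimoduleMorphisms M.rawLeftSemimodule N.rawLeftSemimodule public
    using (IsLeftSemimoduleHomomorphism; module IsLeftSemimoduleHomomorphism)

  isLeftSemimoduleHomomorphism : ∀ (h : M.Carrierᴹ → N.Carrierᴹ) →
    (∀ {x y} → x M.≈ᴹ y → h x N.≈ᴹ h y) → h M.0ᴹ N.≈ᴹ N.0ᴹ →
    (∀ x y → h (x M.+ᴹ y) N.≈ᴹ h x N.+ᴹ h y) → (∀ k x → h (k M.*ₗ x) N.≈ᴹ k N.*ₗ h x) →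
    IsLeftSemimoduleHomomorphism h
  isLeftSemimoduleHomomorphism h h-cong h-0 h-+ h-* = record
    { +ᴹ-isMonoidHomomorphism = record
      { isMagmaHomomorphism = record
        { isRelHomomorphism = record { cong = h-cong }
        ; homo = h-+
        }
      ; ε-homo = h-0
      }
    ; *ₗ-homo = h-*
    }

  homo-∑ : ∀ {h} → IsLeftSemimoduleHomomorphism h → ∀ (f : X → M.Carrierᴹ) xs →
           h (FiniteSum.∑ M xs f) N.≈ᴹ FiniteSum.∑ N xs (h ∘ f)
  homo-∑ {h = h} hom f = go
    where
    open IsLeftSemimoduleHomomorphism hom
    go : ∀ xs → h (FiniteSum.∑ M xs f) N.≈ᴹ FiniteSum.∑ N xs (h ∘ f)
    go []       = 0ᴹ-homo
    go (x ∷ xs) = N.≈ᴹ-trans (+ᴹ-homo _ _) (N.+ᴹ-congˡ (go xs))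

-- `suffixes` runs through the cuts by increasing prefix length `j`, from 0 to `length w` inclusive.
-- `go` works with `applyUpTo` because its recursion shifts `j` as `suffixes` does.
map-suffixes : ∀ (w : List A) (f : List A → List A → X) →
  map (λ (v , u , _) → f v u) (suffixes w) ≡
  map (λ j → f (drop j w) (take j w)) (upTo (suc (length w)))
map-suffixes {A = A} {X = X} w f = ≡.trans (go w f) (≡.sym (List.map-upTo _ (suc (length w))))
  where
  go : ∀ w (f : List A → List A → X) →
    map (λ (v , u , _) → f v u) (suffixes w) ≡
    applyUpTo (λ j → f (drop j w) (take j w)) (suc (length w))
  go []      f = ≡.refl
  go (x ∷ w) f = cong (f (x ∷ w) [] ∷_)
    (≡.trans (≡.sym (List.map-∘ (suffixes w))) (go w λ v u → f v (x ∷ u)))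

-- The coproduct of elementary functions

module Coproduct {c ℓ} (K : Field c ℓ) {a} {A : Set a} {n : ℕ} (finite : A ↔ Fin n) where
  open NSym K finite
  open LinearExtension
  open Field K using (commutativeRing)
  open Module NSym⊗NSym using (≈ᴹ-trans; ≈ᴹ-sym; ≈ᴹ-refl; ≈ᴹ-reflexive; ≈ᴹ-setoid; +ᴹ-abelianGroup)
  open TensorProduct NSym NSym using (⊗-cong; ⊗-zeroˡ; ⊗-distribʳ; ⊗-distribˡ; ⊗-balanced)
  open LinearMaps NSym NSym⊗NSym
  open GroupSums +ᴹ-abelianGroup using (Additive)
  open Additive
  open AlternatingSums A +ᴹ-abelianGroup
  open SignedSums A NSym⊗NSym using (∑-refinements)
  open ≈-Reasoning ≈ᴹ-setoid
  private
    module S = Module NSym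
    module G = GroupSums +ᴹ-abelianGroup

  -- A linear map passes through the sum and the scalar signs in `E I`. It is applied to `Δ` and to
  -- tensoring with a fixed element on either side.
  homo-E : ∀ {h} → IsLeftSemimoduleHomomorphism h → ∀ I → h (E I) ≈⊗ alt I (h ∘ H)
  homo-E {h} hom I = ≈ᴹ-trans (homo-∑ hom _ (refinements I))
    (≈ᴹ-trans (G.∑-cong (refinements I) λ J → *ₗ-homo _ (H J)) (∑-refinements I (h ∘ H)))
    where open IsLeftSemimoduleHomomorphism hom

  Δ-homo : IsLeftSemimoduleHomomorphism Δ
  Δ-homo = ModuleMorphisms.IsModuleHomomorphism.isLeftSemimoduleHomomorphism
    (extend-isModuleHomomorphism NSym⊗NSym _)

  Δ-H : ∀ I → Δ (H I) ≈⊗ split I λ P Q → H P ⊗ H Q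
  Δ-H = extend-basis NSym⊗NSym λ I → split I λ P Q → H P ⊗ H Q

  ⊗-homoˡ : ∀ y → IsLeftSemimoduleHomomorphism (_⊗ y)
  ⊗-homoˡ y = isLeftSemimoduleHomomorphism (_⊗ y)
    (λ {x} {x′} x≈x′ → ⊗-cong {x} {x′} x≈x′ (S.≈ᴹ-refl {y}))
    (⊗-zeroˡ y) (λ x x′ → ⊗-distribʳ x x′ y) (λ _ _ → ≈ᴹ-refl)

  ⊗-homoʳ : ∀ x → IsLeftSemimoduleHomomorphism (x ⊗_)
  ⊗-homoʳ x = isLeftSemimoduleHomomorphism (x ⊗_)
    (λ {y} {y′} → ⊗-cong {x} {x} {y} {y′} (S.≈ᴹ-refl {x}))
    -- Here `0ᴹ` is read as `0# *ₗ 0ᴹ`; balancing moves the zero scalar to the left factor, where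
    -- `⊗-zeroˡ` applies.
    (≈ᴹ-trans (≈ᴹ-sym (⊗-balanced (Field.0# K) x 0ᴹ))
      (≈ᴹ-trans (⊗-cong (S.*ₗ-zeroˡ x) (S.≈ᴹ-refl {0ᴹ})) (⊗-zeroˡ 0ᴹ)))
    (⊗-distribˡ x) (λ k y → ≈ᴹ-sym (⊗-balanced k x y))

  E⊗E : ∀ I J → E I ⊗ E J ≈⊗ alt I λ P → alt J λ Q → H P ⊗ H Q
  E⊗E I J = ≈ᴹ-trans (homo-E (⊗-homoˡ (E J)) I)
    (T-cong (alt-additive I) λ P → homo-E (⊗-homoʳ (H P)) J)

  -- `alt-split` at `φ P Q = H P ⊗ H Q`. Its exchange of `U` and `V` is the reversal of the tensor
  -- factors relative to the coproduct of `H I`.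
  Δ-E : ∀ I → Δ (E I) ≈⊗ ∑⊗ (subsentences I) λ (J , J⊂I) → E (J ~) ⊗ E ((I ∖ J⊂I) ~)
  Δ-E I = begin
    Δ (E I)
      ≈⟨ homo-E Δ-homo I ⟩
    alt I (λ J → Δ (H J))
      ≈⟨ T-cong (alt-additive I) Δ-H ⟩
    alt I (λ J → split J λ P Q → H P ⊗ H Q)
      ≈⟨ alt-split I (λ P Q → H P ⊗ H Q) ⟩
    split I (λ U V → alt V λ P → alt U λ Q → H P ⊗ H Q)
      ≈⟨ split-cong I (λ U V → E⊗E V U) ⟨
    split I (λ U V → E V ⊗ E U) ∎

  Δ-E-word : ∀ w → Δ (E [ w ]) ≈⊗
    ∑⊗ (upTo (suc (List⁺.length w))) λ j → E ⟨ drop j (toList w) ⟩ ⊗ E ⟨ take j (toList w) ⟩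
  Δ-E-word w = begin
    Δ (E [ w ])
      ≈⟨ Δ-E [ w ] ⟩
    split [ w ] (λ U V → E V ⊗ E U)
      ≈⟨ split-∷ w [] (λ U V → E V ⊗ E U) ⟩
    G.∑ (suffixes (toList w)) (λ (v , u , _) → E (⟨ v ⟩ ++ []) ⊗ E (⟨ u ⟩ ++ []))
      ≈⟨ G.∑-cong (suffixes (toList w)) (λ (v , u , _) → ≈ᴹ-reflexive
           (cong₂ (λ V U → E V ⊗ E U) (List.++-identityʳ ⟨ v ⟩) (List.++-identityʳ ⟨ u ⟩))) ⟩
    G.∑ (suffixes (toList w)) (λ (v , u , _) → E ⟨ v ⟩ ⊗ E ⟨ u ⟩)
      ≈⟨ ≈ᴹ-reflexive (cong (foldr _++_ []) (map-suffixes (toList w) λ v u → E ⟨ v ⟩ ⊗ E ⟨ u ⟩)) ⟩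
    ∑⊗ (upTo (suc (List⁺.length w))) (λ j → E ⟨ drop j (toList w) ⟩ ⊗ E ⟨ take j (toList w) ⟩) ∎

proposition3p12 : ∀ {c ℓ a} (K : Field c ℓ) → CharacteristicZero K →
    {A : Set a} {n : ℕ} (finite : A ↔ Fin n) →
    let open NSym K finite in
    ((I : Sentence A) →
    Δ (E I) ≈⊗ ∑⊗ (subsentences I) λ (J , J⊂I) → E (J ~) ⊗ E ((I ∖ J⊂I) ~))
    ×
    ((w : Word A) →
    Δ (E [ w ]) ≈⊗
    ∑⊗ (upTo (suc (List⁺.length w))) λ j →
    E ⟨ drop j (toList w) ⟩ ⊗ E ⟨ take j (toList w) ⟩)
proposition3p12 K _ finite = Coproduct.Δ-E K finite , Coproduct.Δ-E-word K finite
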